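{- Let $L$ be a field of characteristic $0$, and let $$F(\lambda)=\frac{P(\lambda)}{\prod_{1\le i\le n}(\lambda^{j_i}-z_i)}\in L(\lambda),$$ where $P(\lambda)\in L[\lambda]$, the $j_i$ are positive integers, $z_i\in L$, and the factors $\lambda^{j_i}-z_i$ are pairwise relatively prime in $L[\lambda]$. Let $$F=f(\lambda)+\sum_{1\le i\le n}\frac{p_i(\lambda)}{\lambda^{j_i}-z_i}$$ be the partial fraction decomposition, with $f,p_i\in L[\lambda]$ and $\deg p_i<j_i$. Then for each $s$ with $1\le s\le n$, $p_s(\lambda)$ equals the remainder of $$P(\lambda)\prod_{1\le i\le n,\ i\ne s}\mathcal F(\lambda^{j_s}-z_s,\lambda^{j_i}-z_i)$$ when divided by $\lambda^{j_s}-z_s$ as a polynomial in $\lambda$.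
   Context: For positive integers $j,k$ and $a,b\in L$ such that $\lambda^j-a$ and $\lambda^k-b$ are relatively prime, put $j'=j/\gcd(j,k)$, $k'=k/\gcd(j,k)$ and $$\mathcal F(\lambda^j-a,\lambda^k-b)=\frac{\sum_{i=0}^{j'-1}\lambda^{ik}\,b^{\,j'-1-i}}{a^{k'}-b^{j'}}\in L[\lambda]$$ (the denominator is nonzero under the relative primality assumption; $0^0=1$). -}

module Defs where

open import Algebra.Bundles using (CommutativeRing; RawMonoid; Semiring)
import Algebra.Definitions.RawMagma as RawMagmaDefs
import Algebra.Definitions.RawMonoid as RawMonoidDefs
import Algebra.Definitions.RawSemiring as RawSemiringDefs
import Algebra.Properties.CommutativeSemiring.Exp as CommutativeSemiringExp
import Algebra.Properties.Group as GroupProperties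
import Algebra.Properties.Ring as RingProperties
import Algebra.Properties.Semiring.Exp as SemiringExp
open import Data.Empty using (⊥)
open import Data.Fin.Base using (Fin; zero; suc; toℕ; punchIn)
open import Data.Fin.Properties using (punchInᵢ≢i)
open import Data.List.Base using (List; []; _∷_; map; length)
open import Data.Nat.Base as ℕ using (ℕ; zero; suc; NonZero; s≤s)
import Data.Nat.Coprimality as ℕC
import Data.Nat.DivMod as ℕDM
open import Data.Nat.GCD
  using (gcd; gcd[m,n]∣m; gcd[m,n]∣n; gcd[m,n]≢0; m/gcd[m,n]≢0; n/gcd[m,n]≢0; module Bézout)
import Data.Nat.Properties as ℕP
open import Data.Product.Base using (∃-syntax; _×_; _,_; proj₁; proj₂)
open import Data.Sum.Base using (inj₁)
open import Function.Base using (_∘_)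
open import Level using (Level; _⊔_)
import Relation.Binary.Reasoning.Setoid as SetoidReasoning
open import Relation.Binary.PropositionalEquality as ≡ using (_≡_; _≢_)
open import Relation.Nullary using (Dec; ¬_; yes; no; ¬¬-excluded-middle)

-- Equality is not assumed decidable.  The nonzero elements are the x with
-- ¬ (x ≈ 0), so the theory of denominators below goes through ¬ ¬-arguments.
record Field c ℓ : Set (Level.suc (c ⊔ ℓ)) where
  field
    commutativeRing : CommutativeRing c ℓ

  open CommutativeRing commutativeRing public

  field
    1≉0     : 1# ≉ 0#
    inverse : ∀ x → x ≉ 0# → ∃[ y ] x * y ≈ 1#

  inv : ∀ x → x ≉ 0# → Carrier
  inv x x≉0 = proj₁ (inverse x x≉0)

CharacteristicZero : ∀ {c ℓ} → Field c ℓ → Set ℓ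
CharacteristicZero L = ∀ n → n ·1 ≈ 0# → n ≡ 0
  where
  open Field L
  open RawSemiringDefs (Semiring.rawSemiring semiring) using () renaming (_×_ to _·_)
  _·1 : ℕ → Carrier
  n ·1 = n · 1#

module Polynomial {c ℓ : Level} (R : CommutativeRing c ℓ) where

  open CommutativeRing R
  open RingProperties ring using (-0#≈0#)
  open SetoidReasoning setoid

  -- Coefficient lists, lowest degree first.  Trailing zeros are allowed;
  -- _≈ₚ_ ignores them.
  Poly : Set c
  Poly = List Carrier

  coeff : Poly → ℕ → Carrier
  coeff []      _       = 0#
  coeff (a ∷ p) zero    = a
  coeff (a ∷ p) (suc n) = coeff p n

  infix 4 _≈ₚ_
  record _≈ₚ_ (p q : Poly) : Set ℓ where
    constructor coeffwise
    field
      at : ∀ n → coeff p n ≈ coeff q n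
  open _≈ₚ_ public

  infixl 6 _+ₚ_
  _+ₚ_ : Poly → Poly → Poly
  []      +ₚ q       = q
  (a ∷ p) +ₚ []      = a ∷ p
  (a ∷ p) +ₚ (b ∷ q) = (a + b) ∷ (p +ₚ q)

  -ₚ_ : Poly → Poly
  -ₚ_ = map (-_)

  infixl 7 _*ₚ_
  _*ₚ_ : Poly → Poly → Poly
  []      *ₚ q = []
  (a ∷ p) *ₚ q = map (a *_) q +ₚ (0# ∷ (p *ₚ q))

  C : Carrier → Poly
  C a = a ∷ []

  X : Poly
  X = 0# ∷ 1# ∷ []

  -- Degrees, with the zero polynomial having degree -∞.
  infix 4 deg_<_
  deg_<_ : Poly → ℕ → Set ℓ
  deg p < m = ∀ i → m ℕ.≤ i → coeff p i ≈ 0#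

  HasDegree : Poly → ℕ → Set ℓ
  HasDegree p m = ¬ (coeff p m ≈ 0#) × deg p < suc m

  coeff-+ : ∀ p q n → coeff (p +ₚ q) n ≈ coeff p n + coeff q n
  coeff-+ []      q       n       = sym (+-identityˡ _)
  coeff-+ (a ∷ p) []      n       = sym (+-identityʳ _)
  coeff-+ (a ∷ p) (b ∷ q) zero    = refl
  coeff-+ (a ∷ p) (b ∷ q) (suc n) = coeff-+ p q n

  coeff-neg : ∀ p n → coeff (-ₚ p) n ≈ - coeff p n
  coeff-neg []      n       = sym -0#≈0#
  coeff-neg (a ∷ p) zero    = refl
  coeff-neg (a ∷ p) (suc n) = coeff-neg p n

  coeff-scale : ∀ a p n → coeff (map (a *_) p) n ≈ a * coeff p n
  coeff-scale a []      n       = sym (zeroʳ a)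
  coeff-scale a (b ∷ p) zero    = refl
  coeff-scale a (b ∷ p) (suc n) = coeff-scale a p n

  Seq : Set c
  Seq = ℕ → Carrier

  conv : Seq → Seq → Seq
  conv f g zero    = f 0 * g 0
  conv f g (suc n) = f 0 * g (suc n) + conv (f ∘ suc) g n

  infix 4 _≐_
  _≐_ : Seq → Seq → Set ℓ
  f ≐ g = ∀ n → f n ≈ g n

  conv-cong : ∀ {f f′ g g′} → f ≐ f′ → g ≐ g′ → conv f g ≐ conv f′ g′
  conv-cong e d zero    = *-cong (e 0) (d 0)
  conv-cong e d (suc n) =
    +-cong (*-cong (e 0) (d (suc n))) (conv-cong (e ∘ suc) d n)

  conv-zeroˡ : ∀ g → conv (λ _ → 0#) g ≐ (λ _ → 0#)
  conv-zeroˡ g zero    = zeroˡ _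
  conv-zeroˡ g (suc n) = begin
    0# * g (suc n) + conv (λ _ → 0#) g n ≈⟨ +-cong (zeroˡ _) (conv-zeroˡ g n) ⟩
    0# + 0#                              ≈⟨ +-identityˡ 0# ⟩
    0#                                   ∎

  interchange : ∀ a b c d → (a + b) + (c + d) ≈ (a + c) + (b + d)
  interchange a b c d = begin
    (a + b) + (c + d) ≈⟨ +-assoc a b (c + d) ⟩
    a + (b + (c + d)) ≈⟨ +-congˡ (+-assoc b c d) ⟨
    a + ((b + c) + d) ≈⟨ +-congˡ (+-congʳ (+-comm b c)) ⟩
    a + ((c + b) + d) ≈⟨ +-congˡ (+-assoc c b d) ⟩
    a + (c + (b + d)) ≈⟨ +-assoc a c (b + d) ⟨
    (a + c) + (b + d) ∎

  conv-distribʳ : ∀ f g h → conv (λ n → f n + g n) h ≐ (λ n → conv f h n + conv g h n)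
  conv-distribʳ f g h zero    = distribʳ _ _ _
  conv-distribʳ f g h (suc n) = trans
    (+-cong (distribʳ _ _ _) (conv-distribʳ (f ∘ suc) (g ∘ suc) h n))
    (interchange _ _ _ _)

  conv-scaleˡ : ∀ a g h → conv (λ n → a * g n) h ≐ (λ n → a * conv g h n)
  conv-scaleˡ a g h zero    = *-assoc _ _ _
  conv-scaleˡ a g h (suc n) = begin
    (a * g 0) * h (suc n) + conv (λ m → a * g (suc m)) h n
      ≈⟨ +-cong (*-assoc _ _ _) (conv-scaleˡ a (g ∘ suc) h n) ⟩
    a * (g 0 * h (suc n)) + a * conv (g ∘ suc) h n
      ≈⟨ distribˡ _ _ _ ⟨
    a * (g 0 * h (suc n) + conv (g ∘ suc) h n) ∎

  conv-suc : ∀ f g n → conv f g (suc n) ≈ f (suc n) * g 0 + conv f (g ∘ suc) n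
  conv-suc f g zero    = +-comm _ _
  conv-suc f g (suc n) = begin
    f 0 * g (suc (suc n)) + conv (f ∘ suc) g (suc n)
      ≈⟨ +-congˡ (conv-suc (f ∘ suc) g n) ⟩
    f 0 * g (suc (suc n)) + (f (suc (suc n)) * g 0 + conv (f ∘ suc) (g ∘ suc) n)
      ≈⟨ +-assoc _ _ _ ⟨
    (f 0 * g (suc (suc n)) + f (suc (suc n)) * g 0) + conv (f ∘ suc) (g ∘ suc) n
      ≈⟨ +-congʳ (+-comm _ _) ⟩
    (f (suc (suc n)) * g 0 + f 0 * g (suc (suc n))) + conv (f ∘ suc) (g ∘ suc) n
      ≈⟨ +-assoc _ _ _ ⟩
    f (suc (suc n)) * g 0 + (f 0 * g (suc (suc n)) + conv (f ∘ suc) (g ∘ suc) n) ∎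

  conv-comm : ∀ f g → conv f g ≐ conv g f
  conv-comm f g zero    = *-comm _ _
  conv-comm f g (suc n) = begin
    f 0 * g (suc n) + conv (f ∘ suc) g n ≈⟨ +-cong (*-comm _ _) (conv-comm (f ∘ suc) g n) ⟩
    g (suc n) * f 0 + conv g (f ∘ suc) n ≈⟨ conv-suc g f n ⟨
    conv g f (suc n)                     ∎

  conv-assoc : ∀ f g h → conv (conv f g) h ≐ conv f (conv g h)
  conv-assoc f g h zero    = *-assoc _ _ _
  conv-assoc f g h (suc n) = begin
    (f 0 * g 0) * h (suc n) + conv (λ m → f 0 * g (suc m) + conv (f ∘ suc) g m) h n
      ≈⟨ +-cong (*-assoc _ _ _) (conv-distribʳ (λ m → f 0 * g (suc m)) _ h n) ⟩
    f 0 * (g 0 * h (suc n)) + (conv (λ m → f 0 * g (suc m)) h n + conv (conv (f ∘ suc) g) h n)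
      ≈⟨ +-congˡ (+-cong (conv-scaleˡ (f 0) (g ∘ suc) h n) (conv-assoc (f ∘ suc) g h n)) ⟩
    f 0 * (g 0 * h (suc n)) + (f 0 * conv (g ∘ suc) h n + conv (f ∘ suc) (conv g h) n)
      ≈⟨ +-assoc _ _ _ ⟨
    (f 0 * (g 0 * h (suc n)) + f 0 * conv (g ∘ suc) h n) + conv (f ∘ suc) (conv g h) n
      ≈⟨ +-congʳ (distribˡ _ _ _) ⟨
    f 0 * conv g h (suc n) + conv (f ∘ suc) (conv g h) n ∎

  coeff-* : ∀ p q → coeff (p *ₚ q) ≐ conv (coeff p) (coeff q)
  coeff-* []      q n       = sym (conv-zeroˡ (coeff q) n)
  coeff-* (a ∷ p) q zero    = begin
    coeff (map (a *_) q +ₚ (0# ∷ (p *ₚ q))) 0 ≈⟨ coeff-+ (map (a *_) q) _ 0 ⟩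
    coeff (map (a *_) q) 0 + 0#               ≈⟨ +-identityʳ _ ⟩
    coeff (map (a *_) q) 0                    ≈⟨ coeff-scale a q 0 ⟩
    a * coeff q 0                             ∎
  coeff-* (a ∷ p) q (suc n) = begin
    coeff (map (a *_) q +ₚ (0# ∷ (p *ₚ q))) (suc n) ≈⟨ coeff-+ (map (a *_) q) _ (suc n) ⟩
    coeff (map (a *_) q) (suc n) + coeff (p *ₚ q) n ≈⟨ +-cong (coeff-scale a q (suc n)) (coeff-* p q n) ⟩
    a * coeff q (suc n) + conv (coeff p) (coeff q) n ∎

  coeff-1 : ∀ p → coeff (C 1# *ₚ p) ≐ coeff p
  coeff-1 p zero = begin
    coeff (C 1# *ₚ p) 0 ≈⟨ coeff-* (C 1#) p 0 ⟩
    1# * coeff p 0      ≈⟨ *-identityˡ _ ⟩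
    coeff p 0           ∎
  coeff-1 p (suc n) = begin
    coeff (C 1# *ₚ p) (suc n) ≈⟨ coeff-* (C 1#) p (suc n) ⟩
    1# * coeff p (suc n) + conv (λ _ → 0#) (coeff p) n
      ≈⟨ +-cong (*-identityˡ _) (conv-zeroˡ (coeff p) n) ⟩
    coeff p (suc n) + 0# ≈⟨ +-identityʳ _ ⟩
    coeff p (suc n) ∎

  +ₚ-cong : ∀ {p p′ q q′} → p ≈ₚ p′ → q ≈ₚ q′ → p +ₚ q ≈ₚ p′ +ₚ q′
  +ₚ-cong {p} {p′} {q} {q′} e d = coeffwise λ n →
    trans (coeff-+ p q n) (trans (+-cong (at e n) (at d n)) (sym (coeff-+ p′ q′ n)))

  *ₚ-cong : ∀ {p p′ q q′} → p ≈ₚ p′ → q ≈ₚ q′ → p *ₚ q ≈ₚ p′ *ₚ q′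
  *ₚ-cong {p} {p′} {q} {q′} e d = coeffwise λ n →
    trans (coeff-* p q n) (trans (conv-cong (at e) (at d) n) (sym (coeff-* p′ q′ n)))

  -ₚ-cong : ∀ {p q} → p ≈ₚ q → -ₚ p ≈ₚ -ₚ q
  -ₚ-cong {p} {q} e = coeffwise λ n →
    trans (coeff-neg p n) (trans (-‿cong (at e n)) (sym (coeff-neg q n)))

  +ₚ-assoc : ∀ p q r → (p +ₚ q) +ₚ r ≈ₚ p +ₚ (q +ₚ r)
  +ₚ-assoc p q r = coeffwise λ n → begin
    coeff ((p +ₚ q) +ₚ r) n             ≈⟨ coeff-+ (p +ₚ q) r n ⟩
    coeff (p +ₚ q) n + coeff r n        ≈⟨ +-congʳ (coeff-+ p q n) ⟩
    (coeff p n + coeff q n) + coeff r n ≈⟨ +-assoc _ _ _ ⟩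
    coeff p n + (coeff q n + coeff r n) ≈⟨ +-congˡ (coeff-+ q r n) ⟨
    coeff p n + coeff (q +ₚ r) n        ≈⟨ coeff-+ p (q +ₚ r) n ⟨
    coeff (p +ₚ (q +ₚ r)) n             ∎

  +ₚ-comm : ∀ p q → p +ₚ q ≈ₚ q +ₚ p
  +ₚ-comm p q = coeffwise λ n →
    trans (coeff-+ p q n) (trans (+-comm _ _) (sym (coeff-+ q p n)))

  +ₚ-identityʳ : ∀ p → p +ₚ [] ≈ₚ p
  +ₚ-identityʳ p = coeffwise λ n → trans (coeff-+ p [] n) (+-identityʳ _)

  -ₚ-inverseʳ : ∀ p → p +ₚ (-ₚ p) ≈ₚ []
  -ₚ-inverseʳ p = coeffwise λ n →
    trans (coeff-+ p (-ₚ p) n) (trans (+-congˡ (coeff-neg p n)) (-‿inverseʳ _))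

  *ₚ-assoc : ∀ p q r → (p *ₚ q) *ₚ r ≈ₚ p *ₚ (q *ₚ r)
  *ₚ-assoc p q r = coeffwise λ n → begin
    coeff ((p *ₚ q) *ₚ r) n                       ≈⟨ coeff-* (p *ₚ q) r n ⟩
    conv (coeff (p *ₚ q)) (coeff r) n             ≈⟨ conv-cong (coeff-* p q) (λ _ → refl) n ⟩
    conv (conv (coeff p) (coeff q)) (coeff r) n   ≈⟨ conv-assoc _ _ _ n ⟩
    conv (coeff p) (conv (coeff q) (coeff r)) n   ≈⟨ conv-cong (λ _ → refl) (coeff-* q r) n ⟨
    conv (coeff p) (coeff (q *ₚ r)) n             ≈⟨ coeff-* p (q *ₚ r) n ⟨
    coeff (p *ₚ (q *ₚ r)) n                       ∎

  *ₚ-comm : ∀ p q → p *ₚ q ≈ₚ q *ₚ p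
  *ₚ-comm p q = coeffwise λ n →
    trans (coeff-* p q n) (trans (conv-comm _ _ n) (sym (coeff-* q p n)))

  *ₚ-distribʳ : ∀ r p q → (p +ₚ q) *ₚ r ≈ₚ p *ₚ r +ₚ q *ₚ r
  *ₚ-distribʳ r p q = coeffwise λ n → begin
    coeff ((p +ₚ q) *ₚ r) n           ≈⟨ coeff-* (p +ₚ q) r n ⟩
    conv (coeff (p +ₚ q)) (coeff r) n ≈⟨ conv-cong (coeff-+ p q) (λ _ → refl) n ⟩
    conv (λ m → coeff p m + coeff q m) (coeff r) n ≈⟨ conv-distribʳ _ _ _ n ⟩
    conv (coeff p) (coeff r) n + conv (coeff q) (coeff r) n
      ≈⟨ +-cong (coeff-* p r n) (coeff-* q r n) ⟨
    coeff (p *ₚ r) n + coeff (q *ₚ r) n ≈⟨ coeff-+ (p *ₚ r) _ n ⟨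
    coeff (p *ₚ r +ₚ q *ₚ r) n ∎

  ≈ₚ-trans : ∀ {p q r} → p ≈ₚ q → q ≈ₚ r → p ≈ₚ r
  ≈ₚ-trans e d = coeffwise λ n → trans (at e n) (at d n)

  polynomialRing : CommutativeRing c ℓ
  polynomialRing = record
    { Carrier = Poly
    ; _≈_ = _≈ₚ_
    ; _+_ = _+ₚ_
    ; _*_ = _*ₚ_
    ; -_  = -ₚ_
    ; 0#  = []
    ; 1#  = C 1#
    ; isCommutativeRing = record
      { isRing = record
        { +-isAbelianGroup = record
          { isGroup = record
            { isMonoid = record
              { isSemigroup = record
                { isMagma = record
                  { isEquivalence = record
                    { refl  = coeffwise λ _ → refl
                    ; sym   = λ e → coeffwise (sym ∘ at e)
                    ; trans = ≈ₚ-trans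
                    }
                  ; ∙-cong = +ₚ-cong
                  }
                ; assoc = +ₚ-assoc
                }
              ; identity = (λ _ → coeffwise λ _ → refl) , +ₚ-identityʳ
              }
            ; inverse = (λ p → ≈ₚ-trans (+ₚ-comm (-ₚ p) p) (-ₚ-inverseʳ p)) , -ₚ-inverseʳ
            ; ⁻¹-cong = -ₚ-cong
            }
          ; comm = +ₚ-comm
          }
        ; *-cong = *ₚ-cong
        ; *-assoc = *ₚ-assoc
        ; *-identity = (λ p → coeffwise (coeff-1 p))
                     , (λ p → ≈ₚ-trans (*ₚ-comm p (C 1#)) (coeffwise (coeff-1 p)))
        ; distrib = (λ r p q → ≈ₚ-trans (*ₚ-comm r (p +ₚ q))
                                 (≈ₚ-trans (*ₚ-distribʳ r p q)
                                           (+ₚ-cong (*ₚ-comm p r) (*ₚ-comm q r))))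
                  , *ₚ-distribʳ
        }
      ; *-comm = *ₚ-comm
      }
    }

  coeff-∷*-zero : ∀ a p q → coeff ((a ∷ p) *ₚ q) 0 ≈ a * coeff q 0
  coeff-∷*-zero a p q = coeff-* (a ∷ p) q 0

  coeff-∷*-suc : ∀ a p q n →
    coeff ((a ∷ p) *ₚ q) (suc n) ≈ a * coeff q (suc n) + coeff (p *ₚ q) n
  coeff-∷*-suc a p q n =
    trans (coeff-* (a ∷ p) q (suc n)) (+-congˡ (sym (coeff-* p q n)))

module CommutativeRingLemmas {c ℓ : Level} (R : CommutativeRing c ℓ) where

  open CommutativeRing R
  open RawSemiringDefs (Semiring.rawSemiring semiring) using (_^_; _∣_)
  open RawMagmaDefs *-rawMagma using (_,_)
  open SetoidReasoning setoid

  x+[y-x]≈y : ∀ x y → x + (y - x) ≈ y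
  x+[y-x]≈y x y = begin
    x + (y - x)   ≈⟨ +-comm _ _ ⟩
    (y - x) + x   ≈⟨ +-assoc y (- x) x ⟩
    y + (- x + x) ≈⟨ +-congˡ (-‿inverseˡ x) ⟩
    y + 0#        ≈⟨ +-identityʳ y ⟩
    y             ∎

  power-expansion : ∀ {u v w} → u ≈ v + w → ∀ n → ∃[ q ] u ^ n ≈ v ^ n + q * w
  power-expansion {u} {v} {w} u≈v+w zero = 0# , (begin
    1#          ≈⟨ +-identityʳ 1# ⟨
    1# + 0#     ≈⟨ +-congˡ (zeroˡ w) ⟨
    1# + 0# * w ∎)
  power-expansion {u} {v} {w} u≈v+w (suc n) with power-expansion u≈v+w n
  ... | q , e = v ^ n + u * q , (begin
    u * u ^ n                             ≈⟨ *-congˡ e ⟩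
    u * (v ^ n + q * w)                   ≈⟨ distribˡ _ _ _ ⟩
    u * v ^ n + u * (q * w)               ≈⟨ +-cong (*-congʳ u≈v+w) (sym (*-assoc u q w)) ⟩
    (v + w) * v ^ n + (u * q) * w         ≈⟨ +-congʳ (distribʳ _ _ _) ⟩
    (v * v ^ n + w * v ^ n) + (u * q) * w ≈⟨ +-assoc _ _ _ ⟩
    v * v ^ n + (w * v ^ n + (u * q) * w) ≈⟨ +-congˡ (+-congʳ (*-comm _ _)) ⟩
    v * v ^ n + (v ^ n * w + (u * q) * w) ≈⟨ +-congˡ (distribʳ _ _ _) ⟨
    v * v ^ n + (v ^ n + u * q) * w       ∎)

  u-v∣uⁿ-vⁿ : ∀ u v n → (u - v) ∣ (u ^ n - v ^ n)
  u-v∣uⁿ-vⁿ u v n with power-expansion (sym (x+[y-x]≈y v u)) n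
  ... | q , e = q , (begin
    q * (u - v)                     ≈⟨ +-identityʳ _ ⟨
    q * (u - v) + 0#                ≈⟨ +-congˡ (-‿inverseʳ _) ⟨
    q * (u - v) + (v ^ n - v ^ n)   ≈⟨ +-assoc _ _ _ ⟨
    (q * (u - v) + v ^ n) - v ^ n   ≈⟨ +-congʳ (+-comm _ _) ⟩
    (v ^ n + q * (u - v)) - v ^ n   ≈⟨ +-congʳ e ⟨
    u ^ n - v ^ n                   ∎)

gcd-nonZero : ∀ j k .{{_ : NonZero j}} → NonZero (gcd j k)
gcd-nonZero j k = ℕ.≢-nonZero (gcd[m,n]≢0 j k (inj₁ (ℕ.≢-nonZero⁻¹ j)))

module RationalFunctions {c ℓ : Level} (L : Field c ℓ) where

  private
    module K where
      open Field L public
      open RawSemiringDefs (Semiring.rawSemiring semiring) public using (_^_)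
      open SemiringExp semiring public using (^-congˡ; ^-congʳ; ^-homo-*; ^-assocʳ)
      open CommutativeSemiringExp commutativeSemiring public using (^-distrib-*)
      open GroupProperties +-group public using () renaming (x∙y⁻¹≈ε⇒x≈y to x-y≈0⇒x≈y)
      open RingProperties ring public using (-0#≈0#)

  open Polynomial K.commutativeRing public
  open CommutativeRing polynomialRing public
    using (_≈_; _≉_; _+_; _*_; _-_; 0#; 1#)
  open CommutativeRing polynomialRing
    using (*-rawMagma; setoid; semiring; refl; sym; trans; +-cong; *-congˡ; *-congʳ;
           *-identityˡ; *-comm; -‿cong)
  open RawSemiringDefs (Semiring.rawSemiring semiring) public
    using (_^_; _∣_; Coprime; sum; product)
  open RawMagmaDefs *-rawMagma using (_,_)
  open SemiringExp semiring using (^-congʳ; ^-assocʳ)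
  open CommutativeRingLemmas polynomialRing

  binomial : ℕ → K.Carrier → Poly
  binomial j z = X ^ j - C z

  IsRemainder : (p d r : Poly) → Set (c ⊔ ℓ)
  IsRemainder p d r =
    ∃[ q ] p ≈ q * d + r × ∃[ m ] HasDegree d m × deg r < m

  private
    module ≈-Reasoning = SetoidReasoning setoid
    module K-Reasoning = SetoidReasoning K.setoid

  K-zero-product : ∀ {x y} → x K.≉ K.0# → x K.* y K.≈ K.0# → y K.≈ K.0#
  K-zero-product {x} {y} x≉0 xy≈0 with K.inverse x x≉0
  ... | x⁻¹ , e = begin
    y                   ≈⟨ K.*-identityˡ y ⟨
    K.1# K.* y          ≈⟨ K.*-congʳ e ⟨
    (x K.* x⁻¹) K.* y   ≈⟨ K.*-congʳ (K.*-comm x x⁻¹) ⟩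
    (x⁻¹ K.* x) K.* y   ≈⟨ K.*-assoc x⁻¹ x y ⟩
    x⁻¹ K.* (x K.* y)   ≈⟨ K.*-congˡ xy≈0 ⟩
    x⁻¹ K.* K.0#        ≈⟨ K.zeroʳ x⁻¹ ⟩
    K.0#                ∎
    where open K-Reasoning

  ∷≈0 : ∀ {a p} → a K.≈ K.0# → p ≈ 0# → (a ∷ p) ≈ 0#
  ∷≈0 a≈0 p≈0 = coeffwise λ { zero → a≈0 ; (suc n) → at p≈0 n }

  drop-zero : ∀ {a} p q → a K.≈ K.0# → (a ∷ p) * q ≈ 0# → p * q ≈ 0#
  drop-zero {a} p q a≈0 e = coeffwise λ n → begin
    coeff (p * q) n                                ≈⟨ K.+-identityˡ _ ⟨
    K.0# K.+ coeff (p * q) n                       ≈⟨ K.+-congʳ (K.zeroˡ _) ⟨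
    K.0# K.* coeff q (suc n) K.+ coeff (p * q) n   ≈⟨ K.+-congʳ (K.*-congʳ a≈0) ⟨
    a K.* coeff q (suc n) K.+ coeff (p * q) n      ≈⟨ coeff-∷*-suc a p q n ⟨
    coeff ((a ∷ p) * q) (suc n)                    ≈⟨ at e (suc n) ⟩
    K.0#                                           ∎
    where open K-Reasoning

  *-nonzero : ∀ p q → p ≉ 0# → q ≉ 0# → p * q ≉ 0#
  *-nonzero []      q       p≉0 q≉0 e = p≉0 refl
  *-nonzero (a ∷ p) []      p≉0 q≉0 e = q≉0 refl
  *-nonzero (a ∷ p) (b ∷ q) p≉0 q≉0 e =
    ¬¬-excluded-middle (cases (*-nonzero p (b ∷ q)) (*-nonzero (a ∷ p) q))
    where
    ab≈0 : a K.* b K.≈ K.0#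
    ab≈0 = K.trans (K.sym (coeff-∷*-zero a p (b ∷ q))) (at e 0)

    cases : (p ≉ 0# → (b ∷ q) ≉ 0# → p * (b ∷ q) ≉ 0#) →
            ((a ∷ p) ≉ 0# → q ≉ 0# → (a ∷ p) * q ≉ 0#) →
            ¬ Dec (a K.≈ K.0#)
    cases ih₁ ih₂ (yes a≈0) =
      ih₁ (λ p≈0 → p≉0 (∷≈0 a≈0 p≈0)) q≉0 (drop-zero p (b ∷ q) a≈0 e)
    cases ih₁ ih₂ (no  a≉0) =
      ih₂ p≉0 (λ q≈0 → q≉0 (∷≈0 b≈0 q≈0))
        (trans (*-comm (a ∷ p) q)
          (drop-zero q (a ∷ p) b≈0 (trans (*-comm (b ∷ q) (a ∷ p)) e)))
      where b≈0 = K-zero-product a≉0 ab≈0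

  1≉0 : 1# ≉ 0#
  1≉0 e = K.1≉0 (at e 0)

  product-nonzero : ∀ {n} (g : Fin n → Poly) → (∀ i → g i ≉ 0#) → product g ≉ 0#
  product-nonzero {zero}  g g≉0 = 1≉0
  product-nonzero {suc n} g g≉0 =
    *-nonzero _ _ (g≉0 zero) (product-nonzero (g ∘ suc) (g≉0 ∘ suc))

  coeff-C* : ∀ t p n → coeff (C t * p) n K.≈ t K.* coeff p n
  coeff-C* t p zero    = coeff-∷*-zero t [] p
  coeff-C* t p (suc n) = K.trans (coeff-∷*-suc t [] p n) (K.+-identityʳ _)

  coeff-X*-suc : ∀ p n → coeff (X * p) (suc n) K.≈ coeff p n
  coeff-X*-suc p n = begin
    coeff (X * p) (suc n)                             ≈⟨ coeff-∷*-suc K.0# (C K.1#) p n ⟩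
    K.0# K.* coeff p (suc n) K.+ coeff (C K.1# * p) n ≈⟨ K.+-cong (K.zeroˡ _) (at (*-identityˡ p) n) ⟩
    K.0# K.+ coeff p n                                ≈⟨ K.+-identityˡ _ ⟩
    coeff p n                                         ∎
    where open K-Reasoning

  coeff-Xᵍ* : ∀ g p n → coeff (X ^ g * p) (g ℕ.+ n) K.≈ coeff p n
  coeff-Xᵍ* zero    p n = at (*-identityˡ p) n
  coeff-Xᵍ* (suc g) p n = begin
    coeff ((X * X ^ g) * p) (suc (g ℕ.+ n)) ≈⟨ at (*ₚ-assoc X (X ^ g) p) (suc (g ℕ.+ n)) ⟩
    coeff (X * (X ^ g * p)) (suc (g ℕ.+ n)) ≈⟨ coeff-X*-suc (X ^ g * p) (g ℕ.+ n) ⟩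
    coeff (X ^ g * p) (g ℕ.+ n)             ≈⟨ coeff-Xᵍ* g p n ⟩
    coeff p n                               ∎
    where open K-Reasoning

  coeff-binomial* : ∀ g t p n →
    coeff (binomial g t * p) (g ℕ.+ n) K.≈ coeff p n K.- t K.* coeff p (g ℕ.+ n)
  coeff-binomial* g t p n = begin
    coeff (binomial g t * p) m
      ≈⟨ at (*ₚ-distribʳ p (X ^ g) (-ₚ (C t))) m ⟩
    coeff (X ^ g * p + C (K.- t) * p) m
      ≈⟨ coeff-+ (X ^ g * p) _ m ⟩
    coeff (X ^ g * p) m K.+ coeff (C (K.- t) * p) m
      ≈⟨ K.+-cong (coeff-Xᵍ* g p n) (coeff-C* (K.- t) p m) ⟩
    coeff p n K.+ (K.- t) K.* coeff p m
      ≈⟨ K.+-congˡ (-‿distribˡ-* t _) ⟨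
    coeff p n K.- t K.* coeff p m ∎
    where
    open K-Reasoning
    open RingProperties K.ring using (-‿distribˡ-*)
    m = g ℕ.+ n

  binomial∤1 : ∀ g t .{{_ : NonZero g}} → ¬ (binomial g t ∣ 1#)
  binomial∤1 g@(suc g-1) t (q , e) =
    1≉0 (trans (sym e) (*-congʳ {binomial g t} {q} {0#}
          (coeffwise λ n → vanish (length q) n (ℕP.m≤n+m _ n))))
    where
    open K-Reasoning

    step : ∀ n → coeff q n K.≈ t K.* coeff q (g ℕ.+ n)
    step n = K.x-y≈0⇒x≈y _ _ (begin
      coeff q n K.- t K.* coeff q (g ℕ.+ n) ≈⟨ coeff-binomial* g t q n ⟨
      coeff (binomial g t * q) (g ℕ.+ n)    ≈⟨ at (*-comm (binomial g t) q) (g ℕ.+ n) ⟩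
      coeff (q * binomial g t) (g ℕ.+ n)    ≈⟨ at e (g ℕ.+ n) ⟩
      K.0# ∎)

    beyond : ∀ p n → length p ℕ.≤ n → coeff p n K.≈ K.0#
    beyond []      n       _         = K.refl
    beyond (_ ∷ p) (suc n) (s≤s l≤n) = beyond p n l≤n

    vanish : ∀ m n → length q ℕ.≤ n ℕ.+ m → coeff q n K.≈ K.0#
    vanish zero    n l≤ = beyond q n (≡.subst (length q ℕ.≤_) (ℕP.+-identityʳ n) l≤)
    vanish (suc m) n l≤ = begin
      coeff q n                   ≈⟨ step n ⟩
      t K.* coeff q (g ℕ.+ n)     ≈⟨ K.*-congˡ (vanish m (g ℕ.+ n) (ℕP.≤-trans l≤ bound)) ⟩
      t K.* K.0#                  ≈⟨ K.zeroʳ t ⟩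
      K.0#                        ∎
      where
      bound : n ℕ.+ suc m ℕ.≤ (g ℕ.+ n) ℕ.+ m
      bound = ≡.subst (ℕ._≤ (g ℕ.+ n) ℕ.+ m) (≡.sym (ℕP.+-suc n m))
                (s≤s (ℕP.+-monoˡ-≤ m (ℕP.m≤n+m n g-1)))

  binomial-nonzero : ∀ j z .{{_ : NonZero j}} → binomial j z ≉ 0#
  binomial-nonzero j@(suc _) z e = K.1≉0 (begin
    K.1#                                          ≈⟨ K.+-identityʳ _ ⟨
    K.1# K.+ K.0#                                 ≈⟨ K.+-congˡ K.-0#≈0# ⟨
    K.1# K.- K.0#                                 ≈⟨ K.+-congˡ (K.-‿cong (K.zeroʳ z)) ⟨
    coeff 1# 0 K.- z K.* coeff 1# (j ℕ.+ 0)       ≈⟨ coeff-binomial* j z 1# 0 ⟨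
    coeff (binomial j z * 1#) (j ℕ.+ 0)           ≈⟨ at (*-congʳ {1#} e) (j ℕ.+ 0) ⟩
    K.0#                                          ∎)
    where open K-Reasoning

  C-* : ∀ a b → C a * C b ≈ C (a K.* b)
  C-* a b = coeffwise λ where
    zero    → K.+-identityʳ _
    (suc n) → K.refl

  C-^ : ∀ a n → C a ^ n ≈ C (a K.^ n)
  C-^ a zero    = refl
  C-^ a (suc n) = trans (*-congˡ {C a} (C-^ a n)) (C-* a (a K.^ n))

  C-cong : ∀ {a b} → a K.≈ b → C a ≈ C b
  C-cong e = coeffwise λ { zero → e ; (suc n) → K.refl }

  binomial∣ : ∀ g t m {j a} → m ℕ.* g ≡ j → t K.^ m K.≈ a → binomial g t ∣ binomial j a
  binomial∣ g t m {j} {a} ≡.refl tᵐ≈a with u-v∣uⁿ-vⁿ (X ^ g) (C t) m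
  ... | q , e = q , (begin
    q * binomial g t              ≈⟨ e ⟩
    (X ^ g) ^ m - C t ^ m         ≈⟨ +-cong (^-assocʳ X g m) (-‿cong (C-^ t m)) ⟩
    X ^ (g ℕ.* m) - C (t K.^ m)   ≈⟨ +-cong (^-congʳ X (ℕP.*-comm g m)) (-‿cong (C-cong tᵐ≈a)) ⟩
    binomial (m ℕ.* g) a          ∎)
    where open ≈-Reasoning

  ^-nonzero : ∀ {x} n → x K.≉ K.0# → x K.^ n K.≉ K.0#
  ^-nonzero zero    x≉0 e = K.1≉0 e
  ^-nonzero (suc n) x≉0 e = ^-nonzero n x≉0 (K-zero-product x≉0 e)

  0^suc : ∀ {x} n .{{_ : NonZero n}} → x K.≈ K.0# → x K.^ n K.≈ K.0#
  0^suc (suc n) x≈0 = K.trans (K.*-congʳ x≈0) (K.zeroˡ _)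

  -- If m, n are coprime and aⁿ = bᵐ, then a = tᵐ and b = tⁿ for some t.
  private
    root : ∀ {a b b⁻¹} m n x y → 1 ℕ.+ y ℕ.* n ≡ x ℕ.* m →
           b K.* b⁻¹ K.≈ K.1# → a K.^ n K.≈ b K.^ m →
           ∃[ t ] t K.^ m K.≈ a × t K.^ n K.≈ b
    root {a} {b} {b⁻¹} m n x y 1+yn≡xm bb⁻¹≈1 aⁿ≈bᵐ = t , tᵐ≈a , tⁿ≈b
      where
      open K-Reasoning
      t = a K.^ x K.* b⁻¹ K.^ y

      1^ : ∀ k → K.1# K.^ k K.≈ K.1#
      1^ zero    = K.refl
      1^ (suc k) = K.trans (K.*-identityˡ _) (1^ k)

      cancel : ∀ z k → (z K.* b K.^ k) K.* b⁻¹ K.^ k K.≈ z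
      cancel z k = begin
        (z K.* b K.^ k) K.* b⁻¹ K.^ k ≈⟨ K.*-assoc _ _ _ ⟩
        z K.* (b K.^ k K.* b⁻¹ K.^ k) ≈⟨ K.*-congˡ (K.^-distrib-* b b⁻¹ k) ⟨
        z K.* (b K.* b⁻¹) K.^ k       ≈⟨ K.*-congˡ (K.^-congˡ k bb⁻¹≈1) ⟩
        z K.* K.1# K.^ k              ≈⟨ K.*-congˡ (1^ k) ⟩
        z K.* K.1#                    ≈⟨ K.*-identityʳ z ⟩
        z                             ∎

      t^ : ∀ k → t K.^ k K.≈ a K.^ (x ℕ.* k) K.* b⁻¹ K.^ (y ℕ.* k)
      t^ k = K.trans (K.^-distrib-* _ _ k) (K.*-cong (K.^-assocʳ a x k) (K.^-assocʳ b⁻¹ y k))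

      swap : ∀ k → (a K.^ n) K.^ k K.≈ b K.^ (k ℕ.* m)
      swap k = begin
        (a K.^ n) K.^ k ≈⟨ K.^-congˡ k aⁿ≈bᵐ ⟩
        (b K.^ m) K.^ k ≈⟨ K.^-assocʳ b m k ⟩
        b K.^ (m ℕ.* k) ≈⟨ K.^-congʳ b (ℕP.*-comm m k) ⟩
        b K.^ (k ℕ.* m) ∎

      tᵐ≈a : t K.^ m K.≈ a
      tᵐ≈a = begin
        t K.^ m                                             ≈⟨ t^ m ⟩
        a K.^ (x ℕ.* m) K.* b⁻¹ K.^ (y ℕ.* m)               ≈⟨ K.*-congʳ (K.^-congʳ a (≡.sym 1+yn≡xm)) ⟩
        (a K.* a K.^ (y ℕ.* n)) K.* b⁻¹ K.^ (y ℕ.* m)       ≈⟨ K.*-congʳ (K.*-congˡ (K.^-congʳ a (ℕP.*-comm y n))) ⟩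
        (a K.* a K.^ (n ℕ.* y)) K.* b⁻¹ K.^ (y ℕ.* m)       ≈⟨ K.*-congʳ (K.*-congˡ (K.^-assocʳ a n y)) ⟨
        (a K.* (a K.^ n) K.^ y) K.* b⁻¹ K.^ (y ℕ.* m)       ≈⟨ K.*-congʳ (K.*-congˡ (swap y)) ⟩
        (a K.* b K.^ (y ℕ.* m)) K.* b⁻¹ K.^ (y ℕ.* m)       ≈⟨ cancel a (y ℕ.* m) ⟩
        a                                                   ∎

      tⁿ≈b : t K.^ n K.≈ b
      tⁿ≈b = begin
        t K.^ n                                       ≈⟨ t^ n ⟩
        a K.^ (x ℕ.* n) K.* b⁻¹ K.^ (y ℕ.* n)         ≈⟨ K.*-congʳ (K.^-congʳ a (ℕP.*-comm x n)) ⟩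
        a K.^ (n ℕ.* x) K.* b⁻¹ K.^ (y ℕ.* n)         ≈⟨ K.*-congʳ (K.^-assocʳ a n x) ⟨
        (a K.^ n) K.^ x K.* b⁻¹ K.^ (y ℕ.* n)         ≈⟨ K.*-congʳ (swap x) ⟩
        b K.^ (x ℕ.* m) K.* b⁻¹ K.^ (y ℕ.* n)         ≈⟨ K.*-congʳ (K.^-congʳ b (≡.sym 1+yn≡xm)) ⟩
        (b K.* b K.^ (y ℕ.* n)) K.* b⁻¹ K.^ (y ℕ.* n) ≈⟨ cancel b (y ℕ.* n) ⟩
        b                                             ∎

  common-root : ∀ {a b} m n .{{_ : NonZero m}} .{{_ : NonZero n}} → ℕC.Coprime m n →
                a K.^ n K.≈ b K.^ m → ¬ ¬ (∃[ t ] t K.^ m K.≈ a × t K.^ n K.≈ b)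
  common-root {a} {b} m n m⊥n aⁿ≈bᵐ ¬t =
    ¬¬-excluded-middle λ where
      (yes a≈0) → ¬¬-excluded-middle λ where
        (yes b≈0) → ¬t (K.0# , K.trans (0^suc m K.refl) (K.sym a≈0)
                             , K.trans (0^suc n K.refl) (K.sym b≈0))
        (no  b≉0) → ^-nonzero m b≉0 (K.trans (K.sym aⁿ≈bᵐ) (0^suc n a≈0))
      (no  a≉0) → nonzero-case a≉0
        (λ b≈0 → ^-nonzero n a≉0 (K.trans aⁿ≈bᵐ (0^suc m b≈0)))
    where
    nonzero-case : a K.≉ K.0# → b K.≉ K.0# → ⊥
    nonzero-case a≉0 b≉0 with ℕC.coprime-Bézout m⊥n
    ... | Bézout.+- x y eq = ¬t (root m n x y eq (proj₂ (K.inverse b b≉0)) aⁿ≈bᵐ)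
    ... | Bézout.-+ x y eq with root n m y x eq (proj₂ (K.inverse a a≉0)) (K.sym aⁿ≈bᵐ)
    ...   | t , tⁿ≈b , tᵐ≈a = ¬t (t , tᵐ≈a , tⁿ≈b)

  module _ (j k : ℕ) .{{j≢0 : NonZero j}} .{{k≢0 : NonZero k}} (a b : K.Carrier) where

    private
      instance
        gcd≢0 : NonZero (gcd j k)
        gcd≢0 = gcd-nonZero j k

      j′ k′ : ℕ
      j′ = j ℕDM./ gcd j k
      k′ = k ℕDM./ gcd j k

    𝓕-denominator : K.Carrier
    𝓕-denominator = a K.^ k′ K.- b K.^ j′

    𝓕-denominator≉0 : Coprime (binomial j a) (binomial k b) → 𝓕-denominator K.≉ K.0#
    𝓕-denominator≉0 cop den≈0 =
      common-root j′ k′ {{ℕ.≢-nonZero (m/gcd[m,n]≢0 j k)}} {{ℕ.≢-nonZero (n/gcd[m,n]≢0 j k)}}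
        (ℕC.coprime-/gcd j k) (K.x-y≈0⇒x≈y _ _ den≈0)
        λ (t , tʲ≈a , tᵏ≈b) → binomial∤1 (gcd j k) t
          (cop (binomial∣ (gcd j k) t j′ (ℕDM.m/n*n≡m (gcd[m,n]∣m j k)) tʲ≈a)
               (binomial∣ (gcd j k) t k′ (ℕDM.m/n*n≡m (gcd[m,n]∣n j k)) tᵏ≈b))

    -- 𝓕(λ^j − a, λ^k − b), where X plays the role of λ.
    𝓕 : Coprime (binomial j a) (binomial k b) → Poly
    𝓕 cop = C (K.inv 𝓕-denominator (𝓕-denominator≉0 cop))
          * sum {j′} λ i → X ^ (toℕ i ℕ.* k) * C (b K.^ (j′ ℕ.∸ 1 ℕ.∸ toℕ i))

  infix 7 _/_[_]
  record RatFun : Set (c ⊔ ℓ) where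
    constructor _/_[_]
    field
      num   : Poly
      den   : Poly
      den≉0 : den ≉ 0#
  open RatFun public

  infix 4 _≃_
  _≃_ : RatFun → RatFun → Set ℓ
  F ≃ G = num F * den G ≈ num G * den F

  infixl 6 _⊕_
  _⊕_ : RatFun → RatFun → RatFun
  F ⊕ G = (num F * den G + num G * den F) / den F * den G [ *-nonzero _ _ (den≉0 F) (den≉0 G) ]

  fromPoly : Poly → RatFun
  fromPoly p = p / 1# [ 1≉0 ]

  ⊕-rawMonoid : RawMonoid (c ⊔ ℓ) ℓ
  ⊕-rawMonoid = record { _≈_ = _≃_ ; _∙_ = _⊕_ ; ε = fromPoly 0# }

  open RawMonoidDefs ⊕-rawMonoid public using () renaming (sum to ⨁)

  -- punchIn s enumerates the indices i ≠ s.
  ∏≢ : ∀ {n} (s : Fin n) → (∀ i → s ≢ i → Poly) → Poly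
  ∏≢ {suc n} s g = product {n} λ i → g (punchIn s i) (punchInᵢ≢i s i ∘ ≡.sym)

{-# OPTIONS --safe #-}
-- Work modulo d = λ^{j_s} − z_s.  Clearing denominators in the partial fraction
-- decomposition gives P ≡ p_s ∏_{i≠s} (λ^{j_i} − z_i), and 𝓕(d, λ^k − b) is an
-- inverse of λ^k − b: the geometric sum turns the product of the two into
-- (λ^{k j′} − b^{j′}) / (a^{k′} − b^{j′}), where λ^{k j′} = λ^{j k′} ≡ a^{k′}.
module Submission where

open import Defs
open import Algebra.Bundles using (CommutativeRing; Semiring)
import Algebra.Definitions.RawMagma as RawMagmaDefs
import Algebra.Definitions.RawSemiring as RawSemiringDefs
import Algebra.Properties.AbelianGroup as AbelianGroupProperties
import Algebra.Properties.CommutativeMonoid.Sum as CommutativeMonoidSum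
import Algebra.Properties.CommutativeSemigroup as CommutativeSemigroupProperties
import Algebra.Properties.Group as GroupProperties
import Algebra.Properties.Ring as RingProperties
import Algebra.Properties.Semigroup.Divisibility as SemigroupDivisibility
import Algebra.Properties.Semiring.Exp as SemiringExp
import Algebra.Properties.Semiring.Sum as SemiringSum
import Algebra.Solver.Ring.NaturalCoefficients.Default as SemiringSolver
open import Data.Fin.Base using (Fin; zero; suc; toℕ; punchIn)
open import Data.Fin.Properties using (punchInᵢ≢i)
open import Data.List.Base using ([]; _∷_; length)
open import Data.Nat.Base as ℕ using (ℕ; NonZero; zero; suc; s≤s)
open import Data.Nat.DivMod using (*-/-assoc) renaming (_/_ to _div_)
open import Data.Nat.GCD using (gcd; gcd[m,n]∣m; gcd[m,n]∣n)
import Data.Nat.Properties as ℕP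
open import Data.Product.Base using (∃-syntax; _,_; proj₂)
open import Function.Base using (_∘_)
open import Level using (_⊔_)
open import Relation.Binary.Bundles using (Preorder)
import Relation.Binary.Reasoning.Preorder as PreorderReasoning
import Relation.Binary.Reasoning.Setoid as SetoidReasoning
open import Relation.Binary.PropositionalEquality as ≡ using (_≡_; _≢_)

-- Commutative rings: geometric sums and cancellable products.

module RingLemmas {c ℓ} (R : CommutativeRing c ℓ) where

  open CommutativeRing R hiding (zero)
  open RawSemiringDefs (Semiring.rawSemiring semiring) using (_^_; sum; product)
  open SemiringSum semiring using (*-distribˡ-sum; sum-cong-≋; sum-cong-≗)
  open SemiringSolver commutativeSemiring using (solve; _:+_; _:*_; _:=_)
  open CommutativeRingLemmas R using (power-expansion)
  open RawMagmaDefs *-rawMagma using (_∣_; _,_)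

  -- The homogeneous form of (u^n - v^n) / (u - v). With `u` = λ^k, `v` = b and `n` = j′ it is the
  -- numerator of `𝓕`.
  geometricSum : Carrier → Carrier → ℕ → Carrier
  geometricSum u v n = sum {n} λ i → u ^ toℕ i * v ^ (n ℕ.∸ 1 ℕ.∸ toℕ i)

  geometricSum-suc : ∀ u v n → geometricSum u v (suc n) ≈ v ^ n + u * geometricSum u v n
  geometricSum-suc u v n = +-cong (*-identityˡ _) (begin
    sum {n} (λ i → (u * u ^ toℕ i) * v ^ (n ℕ.∸ suc (toℕ i)))
      ≈⟨ sum-cong-≋ {n} (λ i → *-assoc _ _ _) ⟩
    sum {n} (λ i → u * (u ^ toℕ i * v ^ (n ℕ.∸ suc (toℕ i))))
      ≈⟨ *-distribˡ-sum {n} u (λ i → u ^ toℕ i * v ^ (n ℕ.∸ suc (toℕ i))) ⟨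
    u * sum {n} (λ i → u ^ toℕ i * v ^ (n ℕ.∸ suc (toℕ i)))
      -- The shifted sum carries the exponent `n ∸ suc i`, the shorter geometric sum `n ∸ 1 ∸ i`;
      -- they agree under truncated subtraction too.
      ≡⟨ ≡.cong (u *_) (sum-cong-≗ {n} λ i →
           ≡.cong (λ e → u ^ toℕ i * v ^ e) (≡.sym (ℕP.∸-+-assoc n 1 (toℕ i)))) ⟩
    u * geometricSum u v n ∎)
    where open SetoidReasoning setoid

  -- Writing `w` for u - v keeps the telescoping identity free of negation, so the inductive step is
  -- an identity of commutative semirings.
  geometricSum-expansion : ∀ {u v w} → u ≈ v + w → ∀ n →
                           u ^ n ≈ v ^ n + w * geometricSum u v n
  geometricSum-expansion {w = w} u≈v+w zero = sym (trans (+-congˡ (zeroʳ w)) (+-identityʳ 1#))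
  geometricSum-expansion {u} {v} {w} u≈v+w (suc n) = begin
    u * u ^ n                         ≈⟨ *-congˡ (geometricSum-expansion u≈v+w n) ⟩
    u * (v ^ n + w * S)               ≈⟨ distribˡ u _ _ ⟩
    u * v ^ n + u * (w * S)           ≈⟨ +-congʳ (*-congʳ u≈v+w) ⟩
    (v + w) * v ^ n + u * (w * S)
      ≈⟨ solve 5 (λ u v w x S → (v :+ w) :* x :+ u :* (w :* S) := v :* x :+ w :* (x :+ u :* S))
           refl u v w (v ^ n) S ⟩
    v * v ^ n + w * (v ^ n + u * S)   ≈⟨ +-congˡ (*-congˡ (geometricSum-suc u v n)) ⟨
    v * v ^ n + w * geometricSum u v (suc n) ∎
    where
    open SetoidReasoning setoid
    S = geometricSum u v n

  ∣-product : ∀ {n} (f : Fin n → Carrier) i → f i ∣ product f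
  ∣-product {suc n} f i =
    product (f ∘ punchIn i) , trans (*-comm _ _) (sym (product-remove {i = i} f))
    where
    open CommutativeMonoidSum *-commutativeMonoid renaming (sum-remove to product-remove)

  -- Cancellation is a property of the single element: deriving it from `x ≉ 0#` would only give
  -- doubly negated equalities.
  Cancellable : Carrier → Set (c ⊔ ℓ)
  Cancellable x = ∀ {y z} → x * y ≈ x * z → y ≈ z

  product-cancellable : ∀ {n} (f : Fin n → Carrier) → (∀ i → Cancellable (f i)) →
                        Cancellable (product f)
  product-cancellable {zero}  f canc e = trans (sym (*-identityˡ _)) (trans e (*-identityˡ _))
  product-cancellable {suc n} f canc e =
    product-cancellable (f ∘ suc) (canc ∘ suc)
      (canc zero (trans (sym (*-assoc _ _ _)) (trans e (*-assoc _ _ _))))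

  -- Congruence modulo one element.

  module Modulo (d : Carrier) where

    infix 4 _≋_
    -- The witness is oriented as in `IsRemainder`, so a chain of congruences ending at the
    -- remainder computes the quotient. A preorder suffices for such chains.
    _≋_ : Carrier → Carrier → Set (c ⊔ ℓ)
    x ≋ y = ∃[ q ] x ≈ q * d + y

    ≈⇒≋ : ∀ {x y} → x ≈ y → x ≋ y
    ≈⇒≋ x≈y = 0# , trans x≈y (sym (trans (+-congʳ (zeroˡ d)) (+-identityˡ _)))

    ≋-trans : ∀ {x y z} → x ≋ y → y ≋ z → x ≋ z
    ≋-trans {z = z} (p , x≈) (q , y≈) = p + q , trans x≈ (trans (+-congˡ y≈)
      (solve 4 (λ p q d z → p :* d :+ (q :* d :+ z) := (p :+ q) :* d :+ z) refl p q d z))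

    ≋-preorder : Preorder c ℓ (c ⊔ ℓ)
    ≋-preorder = record
      { _≈_ = _≈_
      ; _≲_ = _≋_
      ; isPreorder = record
        { isEquivalence = isEquivalence
        ; reflexive     = ≈⇒≋
        ; trans         = ≋-trans
        }
      }

    ≋-+-congʳ : ∀ {x x′} z → x ≋ x′ → x + z ≋ x′ + z
    ≋-+-congʳ z (p , x≈) = p , trans (+-congʳ x≈) (+-assoc _ _ _)

    ≋-*-cong : ∀ {x x′ y y′} → x ≋ x′ → y ≋ y′ → x * y ≋ x′ * y′
    ≋-*-cong {x′ = x′} {y′ = y′} (p , x≈) (q , y≈) =
      -- The cofactor of `d` once the first factor is split and the second is split only against
      -- `x′`.
      p * (q * d + y′) + x′ * q , trans (*-cong x≈ y≈)
        (solve 5 (λ p q d x y →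
           (p :* d :+ x) :* (q :* d :+ y) := (p :* (q :* d :+ y) :+ x :* q) :* d :+ x :* y)
           refl p q d x′ y′)

    ≋-*-congˡ : ∀ {y y′} x → y ≋ y′ → x * y ≋ x * y′
    ≋-*-congˡ x = ≋-*-cong (≈⇒≋ refl)

    ≋-*-congʳ : ∀ {x x′} y → x ≋ x′ → x * y ≋ x′ * y
    ≋-*-congʳ y x≋x′ = ≋-*-cong x≋x′ (≈⇒≋ refl)

    ∣⇒+≋ : ∀ {x} y → d ∣ x → x + y ≋ y
    ∣⇒+≋ y (q , qd≈x) = q , +-congʳ (sym qd≈x)

    ≋-^ : ∀ {u v} → u ≈ v + d → ∀ n → u ^ n ≋ v ^ n
    ≋-^ u≈v+d n with power-expansion u≈v+d n
    ... | q , e = q , trans e (+-comm _ _)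

    -- Regrouping pairs each factor with its own inverse, so the product of the binomials with i ≠ s
    -- is inverted one binomial at a time.
    product-*-inverse : ∀ {n} (f g : Fin n → Carrier) → (∀ i → f i * g i ≋ 1#) →
                        product f * product g ≋ 1#
    product-*-inverse {zero}  f g fg≋1 = ≈⇒≋ (*-identityˡ 1#)
    product-*-inverse {suc n} f g fg≋1 = begin
      (f zero * product (f ∘ suc)) * (g zero * product (g ∘ suc)) ≈⟨ interchange _ _ _ _ ⟩
      (f zero * g zero) * (product (f ∘ suc) * product (g ∘ suc))
        ∼⟨ ≋-*-cong (fg≋1 zero) (product-*-inverse (f ∘ suc) (g ∘ suc) (fg≋1 ∘ suc)) ⟩
      1# * 1#                                                     ≈⟨ *-identityˡ 1# ⟩
      1#                                                          ∎
      where
      open PreorderReasoning ≋-preorder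
      open CommutativeSemigroupProperties *-commutativeSemigroup using (interchange)

module PartialFractions {c ℓ} (L : Field c ℓ) where

  private
    module K where
      open Field L public
      open RawSemiringDefs (Semiring.rawSemiring semiring) public using (_^_)
      open RingProperties ring public using (-0#≈0#)
      open GroupProperties +-group public using () renaming (x∙y⁻¹≈ε⇒x≈y to x-y≈0⇒x≈y)

  open RationalFunctions L hiding (1≉0)
  open CommutativeRing polynomialRing hiding (_≈_; _≉_; _+_; _*_; _-_; 0#; 1#; zero)
  open RawMagmaDefs *-rawMagma using (_,_)
  open CommutativeRingLemmas polynomialRing using (x+[y-x]≈y)
  open RingLemmas polynomialRing
  open SemiringExp semiring using (^-congʳ; ^-assocʳ)
  open SemiringSum semiring using (sum-cong-≋)
  open SemigroupDivisibility *-semigroup using (x∣ʳy⇒x∣ʳzy)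

  -- Degree and cancellation of binomials.

  -- Serves both halves of `HasDegree`: `n` = 0 gives the leading coefficient 1, and larger `n` the
  -- vanishing above degree `j`.
  coeff-binomial-≥ : ∀ j z .{{_ : NonZero j}} n → coeff (binomial j z) (j ℕ.+ n) K.≈ coeff 1# n
  coeff-binomial-≥ j@(suc _) z n = begin
    coeff (binomial j z) (j ℕ.+ n)             ≈⟨ at (*-identityʳ (binomial j z)) (j ℕ.+ n) ⟨
    coeff (binomial j z * 1#) (j ℕ.+ n)        ≈⟨ coeff-binomial* j z 1# n ⟩
    -- `K.0#` is `coeff 1# (j + n)`, which reduces because `j` is a successor.
    coeff 1# n K.- z K.* K.0#                  ≈⟨ K.+-congˡ (K.-‿cong (K.zeroʳ z)) ⟩
    coeff 1# n K.- K.0#                        ≈⟨ K.+-congˡ K.-0#≈0# ⟩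
    coeff 1# n K.+ K.0#                        ≈⟨ K.+-identityʳ _ ⟩
    coeff 1# n                                 ∎
    where open SetoidReasoning K.setoid

  binomial-hasDegree : ∀ j z .{{_ : NonZero j}} → HasDegree (binomial j z) j
  binomial-hasDegree j z =
      (λ e → K.1≉0 (K.trans (K.sym (coeff-binomial-≥ j z 0))
        (≡.subst (λ m → coeff (binomial j z) m K.≈ K.0#) (≡.sym (ℕP.+-identityʳ j)) e)))
    , λ i j<i → ≡.subst (λ m → coeff (binomial j z) m K.≈ K.0#)
        (≡.trans (ℕP.+-suc j _) (ℕP.m+[n∸m]≡n j<i)) (coeff-binomial-≥ j z (suc (i ℕ.∸ suc j)))

  coeff-beyond-length : ∀ p n → length p ℕ.≤ n → coeff p n K.≈ K.0#
  coeff-beyond-length []      n       _         = K.refl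
  coeff-beyond-length (_ ∷ p) (suc n) (s≤s l≤n) = coeff-beyond-length p n l≤n

  -- Equality of L need not be stable, so *-nonzero cannot be used for cancellation.
  -- Here q n ≈ t * q (g + n), and iterating this leaves the support of q.
  binomial*q≈0⇒q≈0 : ∀ g t .{{_ : NonZero g}} q → binomial g t * q ≈ 0# → q ≈ 0#
  binomial*q≈0⇒q≈0 g@(suc g-1) t q e = coeffwise λ n → vanish (length q) n (ℕP.m≤n+m _ n)
    where
    open SetoidReasoning K.setoid

    vanish : ∀ m n → length q ℕ.≤ n ℕ.+ m → coeff q n K.≈ K.0#
    vanish zero    n l≤ =
      coeff-beyond-length q n (≡.subst (length q ℕ.≤_) (ℕP.+-identityʳ n) l≤)
    vanish (suc m) n l≤ = begin
      coeff q n
        ≈⟨ K.x-y≈0⇒x≈y _ _ (K.trans (K.sym (coeff-binomial* g t q n)) (at e (g ℕ.+ n))) ⟩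
      t K.* coeff q (g ℕ.+ n)
        ≈⟨ K.*-congˡ (vanish m (g ℕ.+ n) (ℕP.≤-trans l≤ bound)) ⟩
      t K.* K.0#
        ≈⟨ K.zeroʳ t ⟩
      K.0# ∎
      where
      -- Since g ≥ 1, each jump from `n` to `g + n` pays for one unit of the fuel `m`.
      bound : n ℕ.+ suc m ℕ.≤ (g ℕ.+ n) ℕ.+ m
      bound = ≡.subst (ℕ._≤ (g ℕ.+ n) ℕ.+ m) (≡.sym (ℕP.+-suc n m))
                (s≤s (ℕP.+-monoˡ-≤ m (ℕP.m≤n+m n g-1)))

  binomial-cancellable : ∀ g t .{{_ : NonZero g}} → Cancellable (binomial g t)
  binomial-cancellable g t {y} {z} e = x∙y⁻¹≈ε⇒x≈y y z
    (binomial*q≈0⇒q≈0 g t (y - z)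
      (trans (x[y-z]≈xy-xz (binomial g t) y z) (x≈y⇒x∙y⁻¹≈ε e)))
    where
    open RingProperties ring using (x[y-z]≈xy-xz)
    open GroupProperties +-group using (x∙y⁻¹≈ε⇒x≈y; x≈y⇒x∙y⁻¹≈ε)

  -- `𝓕` as an inverse modulo a binomial.

  module _ (j k : ℕ) .{{_ : NonZero j}} .{{_ : NonZero k}} (a b : K.Carrier) where

    open Modulo (binomial j a)

    private
      instance
        gcd≢0 : NonZero (gcd j k)
        gcd≢0 = gcd-nonZero j k

      j′ k′ : ℕ
      j′ = j div gcd j k
      k′ = k div gcd j k

      -- Both sides are lcm(j, k), which is why a power of λ^k can be rewritten as a power of λ^j.
      k*j′≡j*k′ : k ℕ.* j′ ≡ j ℕ.* k′
      k*j′≡j*k′ = begin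
        k ℕ.* j′              ≡⟨ *-/-assoc k (gcd[m,n]∣m j k) ⟨
        k ℕ.* j div gcd j k   ≡⟨ ≡.cong (_div gcd j k) (ℕP.*-comm k j) ⟩
        j ℕ.* k div gcd j k   ≡⟨ *-/-assoc j (gcd[m,n]∣n j k) ⟩
        j ℕ.* k′              ∎
        where open ≡.≡-Reasoning

    binomial*geometricSum≋denominator :
      binomial k b * geometricSum (X ^ k) (C b) j′ ≋ C (𝓕-denominator j k a b)
    binomial*geometricSum≋denominator = begin
      binomial k b * S
        -- Adding and subtracting b^j′ exposes the right-hand side of the geometric expansion.
        ≈⟨ xyx⁻¹≈y (C b ^ j′) (binomial k b * S) ⟨
      (C b ^ j′ + binomial k b * S) - C b ^ j′
        ≈⟨ +-congʳ (geometricSum-expansion {w = binomial k b} (sym (x+[y-x]≈y (C b) (X ^ k))) j′) ⟨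
      (X ^ k) ^ j′ - C b ^ j′
        ≈⟨ +-cong Xᵏʲ (-‿cong (C-^ b j′)) ⟩
      (X ^ j) ^ k′ - C (b K.^ j′)
        -- The only step that uses the modulus: λ^j = a + (λ^j - a). All others are equalities.
        ∼⟨ ≋-+-congʳ _ (≋-^ (sym (x+[y-x]≈y (C a) (X ^ j))) k′) ⟩
      C a ^ k′ - C (b K.^ j′)
        ≈⟨ +-congʳ (C-^ a k′) ⟩
      C (𝓕-denominator j k a b) ∎
      where
      open PreorderReasoning ≋-preorder
      open AbelianGroupProperties +-abelianGroup using (xyx⁻¹≈y)
      S = geometricSum (X ^ k) (C b) j′

      Xᵏʲ : (X ^ k) ^ j′ ≈ (X ^ j) ^ k′
      Xᵏʲ = trans (^-assocʳ X k j′) (trans (^-congʳ X k*j′≡j*k′) (sym (^-assocʳ X j k′)))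

    𝓕*binomial≋1 : (cop : Coprime (binomial j a) (binomial k b)) →
                   𝓕 j k a b cop * binomial k b ≋ 1#
    𝓕*binomial≋1 cop = begin
      𝓕 j k a b cop * binomial k b        ≈⟨ *-congʳ (*-congˡ {C x} sum≈) ⟩
      (C x * S) * binomial k b            ≈⟨ *-assoc (C x) S (binomial k b) ⟩
      C x * (S * binomial k b)            ≈⟨ *-congˡ {C x} (*-comm S (binomial k b)) ⟩
      C x * (binomial k b * S)            ∼⟨ ≋-*-congˡ (C x) binomial*geometricSum≋denominator ⟩
      C x * C (𝓕-denominator j k a b)     ≈⟨ C-* x (𝓕-denominator j k a b) ⟩
      C (x K.* 𝓕-denominator j k a b)
        ≈⟨ C-cong (K.trans (K.*-comm _ _) (proj₂ (K.inverse _ (𝓕-denominator≉0 j k a b cop)))) ⟩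
      1#                                  ∎
      where
      open PreorderReasoning ≋-preorder
      x = K.inv (𝓕-denominator j k a b) (𝓕-denominator≉0 j k a b cop)
      S = geometricSum (X ^ k) (C b) j′

      -- `𝓕` is written with λ^(ik) and constants b^e; regrouping them as powers of `X ^ k` and
      -- `C b` gives a geometric sum.
      sum≈ : sum {j′} (λ i → X ^ (toℕ i ℕ.* k) * C (b K.^ (j′ ℕ.∸ 1 ℕ.∸ toℕ i))) ≈ S
      sum≈ = sum-cong-≋ {j′} λ i → *-cong
        (trans (^-congʳ X (ℕP.*-comm (toℕ i) k)) (sym (^-assocʳ X k (toℕ i))))
        (sym (C-^ b (j′ ℕ.∸ 1 ℕ.∸ toℕ i)))

  -- Clearing denominators.

  -- Propositional equality is available because `_⊕_` multiplies denominators without reducing and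
  -- the empty sum has denominator `1#`.
  den-⨁ : ∀ {n} (F : Fin n → RatFun) → den (⨁ F) ≡ product (den ∘ F)
  den-⨁ {zero}  F = ≡.refl
  den-⨁ {suc n} F = ≡.cong (den (F zero) *_) (den-⨁ (F ∘ suc))

  -- Each numerator gets multiplied by all the other denominators, so every term but the one at `s`
  -- is a multiple of `den (F s)`. The induction follows the right nesting of `⨁`.
  num-⨁ : ∀ {n} (F : Fin (suc n) → RatFun) s → let open Modulo (den (F s)) in
          num (⨁ F) ≋ num (F s) * product (den ∘ F ∘ punchIn s)
  num-⨁ F zero = begin
    num (F zero) * den (⨁ (F ∘ suc)) + num (⨁ (F ∘ suc)) * den (F zero)
      ≈⟨ +-comm (num (F zero) * den (⨁ (F ∘ suc))) _ ⟩
    num (⨁ (F ∘ suc)) * den (F zero) + num (F zero) * den (⨁ (F ∘ suc))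
      ∼⟨ ∣⇒+≋ _ (num (⨁ (F ∘ suc)) , refl) ⟩
    num (F zero) * den (⨁ (F ∘ suc))
      ≡⟨ ≡.cong (num (F zero) *_) (den-⨁ (F ∘ suc)) ⟩
    num (F zero) * product (den ∘ F ∘ suc) ∎
    where
    open Modulo (den (F zero))
    open PreorderReasoning ≋-preorder
  num-⨁ {suc n} F (suc s) = begin
    num F₀ * den (⨁ F′) + num (⨁ F′) * den F₀
      ∼⟨ ∣⇒+≋ _ d∣ ⟩
    num (⨁ F′) * den F₀
      ∼⟨ ≋-*-congʳ (den F₀) (num-⨁ F′ s) ⟩
    (num (F′ s) * product (den ∘ F′ ∘ punchIn s)) * den F₀
      ≈⟨ *-assoc (num (F′ s)) _ _ ⟩
    num (F′ s) * (product (den ∘ F′ ∘ punchIn s) * den F₀)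
      -- `punchIn (suc s)` sends `zero` to `zero`, so `den F₀` must be the first factor.
      ≈⟨ *-congˡ {num (F′ s)} (*-comm _ (den F₀)) ⟩
    num (F′ s) * (den F₀ * product (den ∘ F′ ∘ punchIn s)) ∎
    where
    open Modulo (den (F (suc s)))
    open PreorderReasoning ≋-preorder
    F₀ = F zero
    F′ = F ∘ suc

    d∣ : den (F′ s) ∣ num F₀ * den (⨁ F′)
    d∣ = x∣ʳy⇒x∣ʳzy (num F₀) (≡.subst (den (F′ s) ∣_) (≡.sym (den-⨁ F′))
           (∣-product (den ∘ F′) s))

  -- Both fractions have denominator `D` up to a factor `1#`, so the cross-multiplied equality
  -- contains a spare `D` on each side, removed by cancellability.
  ⊕-clear-denominators : ∀ {P f D D≉0} (G : RatFun) → den G ≡ D → Cancellable D →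
                         P / D [ D≉0 ] ≃ fromPoly f ⊕ G → P ≈ f * D + num G
  ⊕-clear-denominators {P} {f} {D} G ≡.refl canc e = canc (begin
    D * P                                ≈⟨ *-comm D P ⟩
    P * D                                ≈⟨ *-congˡ {P} (*-identityˡ D) ⟨
    P * (1# * D)                         ≈⟨ e ⟩
    (f * D + num G * 1#) * D             ≈⟨ *-congʳ {D} (+-congˡ {f * D} (*-identityʳ (num G))) ⟩
    (f * D + num G) * D                  ≈⟨ *-comm _ D ⟩
    D * (f * D + num G)                  ∎)
    where open SetoidReasoning setoid

-- Assembly of the remainder formula.

mainTheorem15 : ∀ {c ℓ} (L : Field c ℓ) → CharacteristicZero L →
    let open Field L using (Carrier)
        open RationalFunctions L
    in
    (n : ℕ) (j : Fin n → ℕ) {{j>0 : ∀ {i} → NonZero (j i)}} (z : Fin n → Carrier) →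
    let d : Fin n → Poly
        d i = binomial (j i) (z i)

        d≉0 : ∀ i → d i ≉ 0#
        d≉0 i = binomial-nonzero (j i) (z i)
    in
    (coprime : ∀ i k → i ≢ k → Coprime (d i) (d k)) →
    (P f : Poly) (p : Fin n → Poly) →
    (∀ i → deg p i < j i) →
    P / product d [ product-nonzero d d≉0 ] ≃ fromPoly f ⊕ ⨁ (λ i → p i / d i [ d≉0 i ]) →
    ∀ s → IsRemainder
            (P * ∏≢ s (λ i s≢i → 𝓕 (j s) (j i) (z s) (z i) (coprime s i s≢i)))
            (d s)
            (p s)
mainTheorem15 L _ (suc n) j z coprime P f p deg-p decomposition s =
  -- The quotient is the witness of the congruence; the degree condition on the remainder is the
  -- hypothesis on `p s`.
  let q , P∏𝓕≈qd+p = P*∏𝓕≋p in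
  q , P∏𝓕≈qd+p , j s , binomial-hasDegree (j s) (z s) , deg-p s
  where
  open RationalFunctions L
  open PartialFractions L
  open CommutativeRing polynomialRing using (*-congʳ; *-congˡ; *-assoc; *-comm; *-identityʳ; *-semigroup)
  open SemigroupDivisibility *-semigroup using (x∣ʳy⇒x∣ʳzy)
  open RingLemmas polynomialRing
  open Modulo (binomial (j s) (z s))
  open PreorderReasoning ≋-preorder

  d : Fin (suc n) → Poly
  d i = binomial (j i) (z i)

  F : Fin (suc n) → RatFun
  F i = p i / d i [ binomial-nonzero (j i) (z i) ]

  D≉0 : product d ≉ 0#
  D≉0 = product-nonzero d (den≉0 ∘ F)

  ∏d ∏𝓕 : Poly
  ∏d = product {n} λ i → d (punchIn s i)
  ∏𝓕 = ∏≢ s λ i s≢i → 𝓕 (j s) (j i) (z s) (z i) (coprime s i s≢i)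

  P*∏𝓕≋p : P * ∏𝓕 ≋ p s
  P*∏𝓕≋p = begin
    P * ∏𝓕
      ≈⟨ *-congʳ {∏𝓕} (⊕-clear-denominators {P} {f} {D≉0 = D≉0} (⨁ F) (den-⨁ F)
           (product-cancellable d λ i → binomial-cancellable (j i) (z i)) decomposition) ⟩
    (f * product d + num (⨁ F)) * ∏𝓕
      -- The polynomial part disappears, as `d s` divides `product d`.
      ∼⟨ ≋-*-congʳ ∏𝓕 (∣⇒+≋ _ (x∣ʳy⇒x∣ʳzy f (∣-product d s))) ⟩
    num (⨁ F) * ∏𝓕
      ∼⟨ ≋-*-congʳ ∏𝓕 (num-⨁ F s) ⟩
    (p s * ∏d) * ∏𝓕
      ≈⟨ *-assoc (p s) ∏d ∏𝓕 ⟩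
    p s * (∏d * ∏𝓕)
      ≈⟨ *-congˡ {p s} (*-comm ∏d ∏𝓕) ⟩
    p s * (∏𝓕 * ∏d)
      ∼⟨ ≋-*-congˡ (p s) (product-*-inverse _ _ λ i →
           𝓕*binomial≋1 (j s) (j (punchIn s i)) (z s) (z (punchIn s i))
             (coprime s (punchIn s i) (punchInᵢ≢i s i ∘ ≡.sym))) ⟩
    p s * 1#
      ≈⟨ *-identityʳ (p s) ⟩
    p s ∎
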